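{- Let $\overrightarrow{W}$ be a Morse sequence on a simplicial complex $K$, with reference map $\curlywedge$ and coreference map $\curlyvee$. Let $\kappa$ be a critical simplex of $\overrightarrow{W}$ and $\nu\in K$. Then (1) $\kappa\in\curlywedge(\nu)$ if and only if the number of gradient paths in $\overrightarrow{W}$ from $\nu$ to $\kappa$ is odd; (2) $\kappa\in\curlyvee(\nu)$ if and only if the number of cogradient paths in $\overrightarrow{W}$ from $\kappa$ to $\nu$ is odd.
   Context: A simplicial complex $K$ is a finite collection of non-empty finite sets closed under taking non-empty subsets; members are simplices, $\dim\sigma=|\sigma|-1$, $K^{(p)}$ is the set of $p$-simplices, a facet is a maximal simplex. A pair $(\sigma,\tau)$ with $\sigma\subsetneq\tau$ is a free pair for $K$ if $\tau$ is the only simplex of $K$ other than $\sigma$ containing $\sigma$; then $K$ is an elementary expansion of $K\setminus\{\sigma,\tau\}$. If $\nu$ is a facet of $K$, $K$ is an elementary filling of $K\setminus\{\nu\}$. A Morse sequence on $K$ is a sequence $\langle\emptyset=K_0,\dots,K_k=K\rangle$ with each $K_i$ an elementary expansion or elementary filling of $K_{i-1}$. A simplex added by a filling is critical; if $K_i=K_{i-1}\cup\{\sigma,\tau\}$ is an expansion with $\sigma\subset\tau$, $(\sigma,\tau)$ is a regular pair, $\sigma$ is lower regular and $\tau$ upper regular. Chains mod 2: $K[p]$ is the $\mathbb{Z}_2$-vector space of subsets of $K^{(p)}$ (sum = symmetric difference, empty chain $=0$). For $\sigma\in K^{(p)}$, $\partial(\sigma)=\{\tau\in K^{(p-1)}:\tau\subset\sigma\}$,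 $\delta(\sigma)=\{\tau\in K^{(p+1)}:\sigma\subset\tau\}$. The reference map $\curlywedge$ is the unique map assigning to each $p$-simplex $\nu$ a set $\curlywedge(\nu)$ of critical $p$-simplices, extended linearly to chains ($\curlywedge(c)=\sum_{\nu\in c}\curlywedge(\nu)$ mod 2), such that $\curlywedge(\nu)=\{\nu\}$ for critical $\nu$, and $\curlywedge(\tau)=0$, $\curlywedge(\partial(\tau))=0$ for every upper regular $\tau$. The coreference map $\curlyvee$ is the unique such map with $\curlyvee(\nu)=\{\nu\}$ for critical $\nu$ and $\curlyvee(\sigma)=0$, $\curlyvee(\delta(\sigma))=0$ for every lower regular $\sigma$. A gradient path in $\overrightarrow{W}$ from $\sigma_0$ to $\sigma_k$ is a sequence $\langle\sigma_0,\tau_0,\dots,\sigma_{k-1},\tau_{k-1},\sigma_k\rangle$, $k\ge0$, with $\sigma_i\in K^{(p)}$, $\tau_i\in K^{(p+1)}$, such that for each $i\in[0,k-1]$, $(\sigma_i,\tau_i)$ is a regular pair and $\sigma_{i+1}\in\partial(\tau_i)$ with $\sigma_{i+1}\neq\sigma_i$. A cogradient path from $\tau_0$ to $\tau_k$ is a sequence $\langle\tau_0,\sigma_1,\tau_1,\dots,\sigma_k,\tau_k\rangle$, $k\ge0$, with $\tau_i\in K^{(p)}$, $\sigma_i\in K^{(p-1)}$, such that for each $i\in[1,k]$, $(\sigma_i,\tau_i)$ is a regular pair and $\tau_{i-1}\in\delta(\sigma_i)$ with $\tau_i\neq\tau_{i-1}$. (Paths with $k=0$ are trivial paths $\langle\sigma_0\rangle$.)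 -}

module Defs where

open import Data.Bool using (Bool; false; T; _∧_; _∨_; not; _xor_)
import Data.Bool.Properties as Bool
open import Data.Fin using (Fin; zero; suc; fromℕ; inject₁)
open import Data.Fin.Subset using (Subset; Nonempty; ∣_∣; _⊆_; _⊂_; inside; outside)
open import Data.Fin.Subset.Properties using (_⊆?_)
open import Data.List using (List; []; _∷_; _++_; map; foldr; length)
import Data.List.Membership.Propositional as List
open import Data.List.Relation.Unary.Unique.Propositional using (Unique)
open import Data.Nat using (ℕ; suc; _∸_; _%_; _≟_)
open import Data.Product using (∃-syntax; _×_)
open import Data.Sum using (_⊎_)
import Data.Vec as Vec
import Data.Vec.Properties as Vec
open import Function.Bundles using (_⇔_)
open import Relation.Binary.Definitions using (DecidableEquality)
open import Relation.Binary.PropositionalEquality using (_≡_; _≢_; _≗_)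
open import Relation.Nullary using (does)

-- The vertices are the elements of Fin n, and a family of finite vertex sets
-- is given by its characteristic function.  Two families are equal as sets
-- when they are related by _≗_.

Family : ℕ → Set
Family n = Subset n → Bool

infix 4 _∈ᶠ_
_∈ᶠ_ : ∀ {n} → Subset n → Family n → Set
σ ∈ᶠ F = T (F σ)

_≟ˢ_ : ∀ {n} → DecidableEquality (Subset n)
_≟ˢ_ = Vec.≡-dec Bool._≟_

∅ : ∀ {n} → Family n
∅ _ = false

｛_｝ : ∀ {n} → Subset n → Family n
｛ σ ｝ ρ = does (ρ ≟ˢ σ)

infixl 6 _∪ᶠ_ _∖_
_∪ᶠ_ _∖_ : ∀ {n} → Family n → Family n → Family n
(F ∪ᶠ G) ρ = F ρ ∨ G ρ
(F ∖ G) ρ = F ρ ∧ not (G ρ)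

record Complex (n : ℕ) : Set where
  field
    simplices : Family n
    nonempty  : ∀ σ → σ ∈ᶠ simplices → Nonempty σ
    closed    : ∀ σ τ → τ ∈ᶠ simplices → σ ⊆ τ → Nonempty σ → σ ∈ᶠ simplices

open Complex public

infix 4 _∈ᴷ_
_∈ᴷ_ : ∀ {n} → Subset n → Complex n → Set
σ ∈ᴷ K = σ ∈ᶠ simplices K

-- The truncated subtraction is harmless on simplices, which are nonempty.
dim : ∀ {n} → Subset n → ℕ
dim σ = ∣ σ ∣ ∸ 1

infix 4 _∈_⟨_⟩
_∈_⟨_⟩ : ∀ {n} → Subset n → Complex n → ℕ → Set
σ ∈ K ⟨ p ⟩ = σ ∈ᴷ K × dim σ ≡ p

IsFacet : ∀ {n} → Complex n → Subset n → Set
IsFacet K ν = ν ∈ᴷ K × (∀ ρ → ρ ∈ᴷ K → ν ⊆ ρ → ρ ≡ ν)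

IsFreePair : ∀ {n} → Complex n → Subset n → Subset n → Set
IsFreePair K σ τ =
  σ ∈ᴷ K × τ ∈ᴷ K × σ ⊂ τ × (∀ ρ → ρ ∈ᴷ K → σ ⊆ ρ → ρ ≢ σ → ρ ≡ τ)

-- IsExpansion L K σ τ: K is an elementary expansion of L = K ∖ {σ, τ}.
IsExpansion : ∀ {n} → Complex n → Complex n → Subset n → Subset n → Set
IsExpansion L K σ τ =
  IsFreePair K σ τ × simplices L ≗ simplices K ∖ (｛ σ ｝ ∪ᶠ ｛ τ ｝)

-- IsFilling L K ν: K is an elementary filling of L = K ∖ {ν}.
IsFilling : ∀ {n} → Complex n → Complex n → Subset n → Set
IsFilling L K ν = IsFacet K ν × simplices L ≗ simplices K ∖ ｛ ν ｝

record MorseSequence {n : ℕ} (K : Complex n) : Set where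
  field
    len   : ℕ
    stage : Fin (suc len) → Complex n
    start : simplices (stage zero) ≗ ∅
    end   : simplices (stage (fromℕ len)) ≗ simplices K
    step  : (i : Fin len) →
            (∃[ σ ] ∃[ τ ] IsExpansion (stage (inject₁ i)) (stage (suc i)) σ τ)
            ⊎ (∃[ ν ] IsFilling (stage (inject₁ i)) (stage (suc i)) ν)

allSubsets : ∀ n → List (Subset n)
allSubsets 0       = Vec.[] ∷ []
allSubsets (suc n) =
  map (outside Vec.∷_) (allSubsets n) ++ map (inside Vec.∷_) (allSubsets n)

Chain : ℕ → Set
Chain = Family

∂ : ∀ {n} → Complex n → Subset n → Chain n
∂ K σ τ = simplices K τ ∧ does (τ ⊆? σ) ∧ does (dim σ ≟ suc (dim τ))

δ : ∀ {n} → Complex n → Subset n → Chain n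
δ K σ τ = simplices K τ ∧ does (σ ⊆? τ) ∧ does (dim τ ≟ suc (dim σ))

-- f ⟦ c ⟧ is the sum mod 2 of f ν over all ν in c.
_⟦_⟧ : ∀ {n} → (Subset n → Chain n) → Chain n → Chain n
_⟦_⟧ {n} f c κ = foldr _xor_ false (map (λ ν → c ν ∧ f ν κ) (allSubsets n))

module _ {n : ℕ} {K : Complex n} (W : MorseSequence K) where
  open MorseSequence W

  IsCritical : Subset n → Set
  IsCritical ν = ∃[ i ] IsFilling (stage (inject₁ i)) (stage (suc i)) ν

  IsRegularPair : Subset n → Subset n → Set
  IsRegularPair σ τ = ∃[ i ] IsExpansion (stage (inject₁ i)) (stage (suc i)) σ τ

  IsLowerRegular : Subset n → Set
  IsLowerRegular σ = ∃[ τ ] IsRegularPair σ τ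

  IsUpperRegular : Subset n → Set
  IsUpperRegular τ = ∃[ σ ] IsRegularPair σ τ

  -- Only the values of the map at simplices of K are constrained.
  record IsReferenceMap (⋏ : Subset n → Chain n) : Set where
    field
      critical-valued : ∀ p ν → ν ∈ K ⟨ p ⟩ → ∀ κ → κ ∈ᶠ ⋏ ν →
                        IsCritical κ × κ ∈ K ⟨ p ⟩
      on-critical     : ∀ ν → IsCritical ν → ⋏ ν ≗ ｛ ν ｝
      on-upper        : ∀ τ → IsUpperRegular τ → ⋏ τ ≗ ∅
      on-∂-upper      : ∀ τ → IsUpperRegular τ → ⋏ ⟦ ∂ K τ ⟧ ≗ ∅

  record IsCoreferenceMap (⋎ : Subset n → Chain n) : Set where
    field
      critical-valued : ∀ p ν → ν ∈ K ⟨ p ⟩ → ∀ κ → κ ∈ᶠ ⋎ ν →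
                        IsCritical κ × κ ∈ K ⟨ p ⟩
      on-critical     : ∀ ν → IsCritical ν → ⋎ ν ≗ ｛ ν ｝
      on-lower        : ∀ σ → IsLowerRegular σ → ⋎ σ ≗ ∅
      on-δ-lower      : ∀ σ → IsLowerRegular σ → ⋎ ⟦ δ K σ ⟧ ≗ ∅

  -- IsGradientPathᵖ p ν κ π: the list π = ⟨σ₀, τ₀, …, σₖ⟩ is a gradient path
  -- of p-simplices and (p+1)-simplices, with σ₀ = ν and σₖ = κ.
  data IsGradientPathᵖ (p : ℕ) : Subset n → Subset n → List (Subset n) → Set where
    trivial : ∀ {σ} → σ ∈ K ⟨ p ⟩ → IsGradientPathᵖ p σ σ (σ ∷ [])
    extend  : ∀ {σ τ σ′ κ π} →
              σ ∈ K ⟨ p ⟩ → τ ∈ K ⟨ suc p ⟩ →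
              IsRegularPair σ τ → σ′ ∈ᶠ ∂ K τ → σ′ ≢ σ →
              IsGradientPathᵖ p σ′ κ π →
              IsGradientPathᵖ p σ κ (σ ∷ τ ∷ π)

  IsGradientPath : Subset n → Subset n → List (Subset n) → Set
  IsGradientPath ν κ π = ∃[ p ] IsGradientPathᵖ p ν κ π

  -- IsCogradientPathᵖ p κ ν π: the list π = ⟨τ₀, σ₁, τ₁, …, σₖ, τₖ⟩ is a
  -- cogradient path of p-simplices and (p-1)-simplices, with τ₀ = κ and τₖ = ν.
  -- For p = 0 only trivial paths exist, as there are no (-1)-simplices.
  data IsCogradientPathᵖ : ℕ → Subset n → Subset n → List (Subset n) → Set where
    trivial : ∀ {p τ} → τ ∈ K ⟨ p ⟩ → IsCogradientPathᵖ p τ τ (τ ∷ [])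
    extend  : ∀ {q τ σ τ′ ν π} →
              τ ∈ K ⟨ suc q ⟩ → σ ∈ K ⟨ q ⟩ →
              IsRegularPair σ τ′ → τ ∈ᶠ δ K σ → τ′ ≢ τ →
              IsCogradientPathᵖ (suc q) τ′ ν π →
              IsCogradientPathᵖ (suc q) τ ν (τ ∷ σ ∷ π)

  IsCogradientPath : Subset n → Subset n → List (Subset n) → Set
  IsCogradientPath κ ν π = ∃[ p ] IsCogradientPathᵖ p κ ν π

-- HasCardinality P m: exactly m elements satisfy P, as witnessed by a
-- duplicate-free list of them.
HasCardinality : {A : Set} → (A → Set) → ℕ → Set
HasCardinality P m =
  ∃[ xs ] Unique xs × (∀ x → (x List.∈ xs) ⇔ P x) × length xs ≡ m

Odd : ℕ → Set
Odd m = m % 2 ≡ 1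

{-# OPTIONS --safe #-}

-- Both parts are inductions along the Morse sequence.  If (σ, τ) is a regular
-- pair, then ⋏(∂ τ) = 0 says that ⋏(σ) is the sum of the ⋏(σ′) over the faces
-- σ′ ≠ σ of τ, and the gradient paths from σ satisfy the same recursion, a path
-- being classified by its second lower simplex σ′.  Those σ′ enter the sequence
-- before the pair, because K_i ∖ K_{i-1} = {σ, τ}.  Dually, ⋎(δ σ) = 0 expresses
-- ⋎(τ) through the cofaces τ′ ≠ τ of σ, and cogradient paths ending at τ are
-- classified by the penultimate τ′.  As (σ, τ) is free, those τ′ enter later, so
-- that induction runs backwards.  At the other simplices only trivial paths occur.

module Submission where

open import Defs
open import Data.Bool using (Bool; true; false; T; _∧_; not; _xor_)
open import Data.Bool.Properties using (T-∧; T-∨; T-≡; ∧-zeroʳ; ∧-identityʳ; xor-assoc; xor-comm; not-distribˡ-xor)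
open import Data.Empty using (⊥-elim)
open import Data.Fin using (Fin; zero; suc; fromℕ; inject₁)
import Data.Fin as Fin
open import Data.Fin.Induction using (<-weakInduction; <-weakInduction-startingFrom; >-weakInduction)
import Data.Fin.Properties as Fin
open import Data.Fin.Subset using (Subset; Nonempty; ∣_∣; _∈_; _∉_; _⊆_; _⊂_; ⁅_⁆; _∪_; inside; outside)
open import Data.Fin.Subset.Properties using (⊂-irref; ⊂-asymmetric; p⊂q⇒p⊆q; p⊆p∪q; q⊆p∪q; x∈p∪q⁻; x∈⁅x⁆; x∈⁅y⁆⇒x≡y; ∪-identityʳ; _⊆?_)
open import Data.List using (List; []; _∷_; [_]; _++_; map; foldr; length)
open import Data.List.Membership.Propositional using () renaming (_∈_ to _∈ˡ_)
open import Data.List.Membership.Propositional.Properties using (∈-map⁺; ∈-map⁻; ∈-++⁺ˡ; ∈-++⁺ʳ; ∈-++⁻)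
open import Data.List.Properties using (map-cong-local; length-++; length-map; ∷-injectiveʳ; ++-cancelʳ)
open import Data.List.Relation.Unary.All as All using ()
open import Data.List.Relation.Unary.AllPairs using ([]; _∷_)
open import Data.List.Relation.Unary.Any using (here; there)
open import Data.List.Relation.Unary.Unique.Propositional using (Unique)
open import Data.List.Relation.Unary.Unique.Propositional.Properties using (map⁺; ++⁺; Unique[x∷xs]⇒x∉xs)
open import Data.Nat using (ℕ; zero; suc; _+_; _≟_)
open import Data.Nat.Properties using (≤-trans; ≤-reflexive; suc-injective; 1+n≢n)
import Data.Product as Product
open import Data.Product using (∃-syntax; _×_; _,_; proj₁; proj₂; map₂)
open import Data.Sum using (_⊎_; inj₁; inj₂; [_,_]′)
import Data.Vec as Vec
import Data.Vec.Properties as Vec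
open import Function using (_∘_)
open import Function.Bundles using (_⇔_; mk⇔; Equivalence)
open import Relation.Binary.Definitions using (tri<; tri≈; tri>)
open import Relation.Binary.PropositionalEquality using (_≡_; _≢_; _≗_; refl; sym; trans; cong; subst)
open import Relation.Nullary using (¬_; Dec; yes; no; does; contradiction)

open Equivalence using (to; from)

private variable
  A B : Set
  n : ℕ

-- Parities of finite sets

parity : ℕ → Bool
parity zero    = false
parity (suc m) = not (parity m)

parity-+ : ∀ l m → parity (l + m) ≡ parity l xor parity m
parity-+ zero    m = refl
parity-+ (suc l) m = trans (cong not (parity-+ l m)) (not-distribˡ-xor (parity l) (parity m))

T-parity⇔Odd : ∀ m → T (parity m) ⇔ Odd m
T-parity⇔Odd zero          = mk⇔ (λ ()) (λ ())
T-parity⇔Odd (suc zero)    = mk⇔ (λ _ → refl) _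
T-parity⇔Odd (suc (suc m)) with parity m | T-parity⇔Odd m
... | true  | eq = eq
... | false | eq = eq

-- The parity is a Boolean because chain values are Booleans: disjoint unions of path sets then
-- match `xor` of chain values.
HasParity : (A → Set) → Bool → Set
HasParity P b = ∃[ m ] HasCardinality P m × b ≡ parity m

hasParity⇒odd : ∀ {P : A → Set} {b} → HasParity P b →
                ∃[ m ] HasCardinality P m × (T b ⇔ Odd m)
hasParity⇒odd (m , card , refl) = m , card , T-parity⇔Odd m

hasParity-resp-⇔ : ∀ {P Q : A → Set} {b} → (∀ x → P x ⇔ Q x) → HasParity P b → HasParity Q b
hasParity-resp-⇔ P⇔Q (m , (xs , xs! , ∈⇔P , eq) , b≡) =
  m , (xs , xs! , (λ x → mk⇔ (to (P⇔Q x) ∘ to (∈⇔P x)) (from (∈⇔P x) ∘ from (P⇔Q x))) , eq) , b≡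

hasParity-empty : ∀ {P : A → Set} → (∀ x → ¬ P x) → HasParity P false
hasParity-empty ¬P = 0 , ([] , [] , (λ x → mk⇔ (λ ()) (⊥-elim ∘ ¬P x)) , refl) , refl

hasParity-singleton : (a : A) (b? : Dec B) → HasParity (λ x → B × x ≡ a) (does b?)
hasParity-singleton a (no ¬b) = hasParity-empty (λ _ → ¬b ∘ proj₁)
hasParity-singleton a (yes b) =
  1 , ([ a ] , (All.[] ∷ []) , (λ x → mk⇔ (λ { (here eq) → b , eq ; (there ()) }) (here ∘ proj₂)) , refl) , refl

hasParity-⊎ : ∀ {P Q : A → Set} {b c} → (∀ x → P x → ¬ Q x) →
              HasParity P b → HasParity Q c → HasParity (λ x → P x ⊎ Q x) (b xor c)
hasParity-⊎ P∩Q=∅ (_ , (xs , xs! , ∈⇔P , refl) , refl) (_ , (ys , ys! , ∈⇔Q , refl) , refl) =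
  _ , (xs ++ ys
      , ++⁺ xs! ys! (λ { (x∈xs , x∈ys) → P∩Q=∅ _ (to (∈⇔P _) x∈xs) (to (∈⇔Q _) x∈ys) })
      , (λ x → mk⇔
          ([ inj₁ ∘ to (∈⇔P x) , inj₂ ∘ to (∈⇔Q x) ]′ ∘ ∈-++⁻ xs)
          [ ∈-++⁺ˡ ∘ from (∈⇔P x) , ∈-++⁺ʳ xs ∘ from (∈⇔Q x) ]′)
      , length-++ xs)
    , sym (parity-+ (length xs) (length ys))

hasParity-image : ∀ {P : A → Set} {b} {g : A → B} → (∀ {x y} → g x ≡ g y → x ≡ y) →
                  HasParity P b → HasParity (λ y → ∃[ x ] P x × y ≡ g x) b
hasParity-image {g = g} g-inj (m , (xs , xs! , ∈⇔P , refl) , b≡) =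
  m , (map g xs , map⁺ g-inj xs!
      , (λ y → mk⇔
          (λ y∈ → let x , x∈ , eq = ∈-map⁻ g y∈ in x , to (∈⇔P x) x∈ , eq)
          (λ { (x , Px , refl) → ∈-map⁺ g (from (∈⇔P x) Px) }))
      , length-map g xs)
    , b≡

-- Sums mod 2

⨁ : List A → (A → Bool) → Bool
⨁ xs f = foldr _xor_ false (map f xs)

-- `Q-inj` makes the sets `Q x` pairwise disjoint, so their parities add. `Q-par` asks only about
-- `x` in `c`, since the induction hypotheses will cover just those simplices.
hasParity-⨁ : ∀ {Q : A → B → Set} (c f : A → Bool) → (∀ {x y b} → Q x b → Q y b → x ≡ y) →
              (∀ x → T (c x) → HasParity (Q x) (f x)) →
              ∀ {xs} → Unique xs →
              HasParity (λ b → ∃[ x ] x ∈ˡ xs × T (c x) × Q x b) (⨁ xs (λ x → c x ∧ f x))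
hasParity-⨁ c f Q-inj Q-par [] = hasParity-empty (λ { _ (_ , () , _) })
hasParity-⨁ {Q = Q} c f Q-inj Q-par {x ∷ xs} xs!@(_ ∷ xs!′) =
  hasParity-resp-⇔
    (λ b → mk⇔
      (λ { (inj₁ (cx , q)) → x , here refl , cx , q
         ; (inj₂ (y , y∈ , cy , q)) → y , there y∈ , cy , q })
      (λ { (_ , here refl , cx , q) → inj₁ (cx , q)
         ; (y , there y∈ , cy , q) → inj₂ (y , y∈ , cy , q) }))
    (hasParity-⊎
      (λ { b (_ , q) (y , y∈ , _ , q′) →
             Unique[x∷xs]⇒x∉xs xs! (subst (_∈ˡ xs) (Q-inj q′ q) y∈) })
      (head-par (c x) refl)
      (hasParity-⨁ c f Q-inj Q-par xs!′))
  where
  -- The value of `c x` is a separate argument, so that matching on it reduces `cx ∧ f x` while the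
  -- equation still decides `T (c x)`.
  head-par : ∀ cx → c x ≡ cx → HasParity (λ b → T (c x) × Q x b) (cx ∧ f x)
  head-par false eq = hasParity-empty (λ _ p → subst T eq (proj₁ p))
  head-par true  eq = hasParity-resp-⇔ (λ b → mk⇔ (tx ,_) proj₂) (Q-par x tx)
    where tx = from T-≡ eq

-- `h` is `g` with its value at `x` set to zero. As `x` occurs once in `xs`, its term can be moved
-- to the front by commutativity.
⨁-delete : ∀ {g h : A → Bool} {x} → h x ≡ false → (∀ y → y ≢ x → g y ≡ h y) →
           ∀ {xs} → Unique xs → x ∈ˡ xs → ⨁ xs g ≡ g x xor ⨁ xs h
⨁-delete {g = g} {h} {x} hx g≗h {_ ∷ xs} (x∉ ∷ _) (here refl) rewrite hx =
  cong (λ bs → g x xor foldr _xor_ false bs)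
       (map-cong-local (All.map (λ x≢y → g≗h _ (x≢y ∘ sym)) x∉))
⨁-delete {g = g} {h} {x} hx g≗h {y ∷ ys} (y∉ ∷ ys!) (there x∈)
  rewrite g≗h y (All.lookup y∉ x∈) | ⨁-delete {g = g} {h} hx g≗h ys! x∈ =
  trans (sym (xor-assoc (h y) (g x) _))
        (trans (cong (_xor ⨁ ys h) (xor-comm (h y) (g x))) (xor-assoc (g x) (h y) _))

xor≡false⇒≡ : ∀ x y → x xor y ≡ false → x ≡ y
xor≡false⇒≡ false false _ = refl
xor≡false⇒≡ true  true  _ = refl

-- Families of vertex sets

T-does : (a? : Dec A) → T (does a?) ⇔ A
T-does (yes a) = mk⇔ (λ _ → a) _
T-does (no ¬a) = mk⇔ (λ ()) ¬a

T-not : ∀ b → T (not b) ⇔ (¬ T b)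
T-not false = mk⇔ (λ _ ()) _
T-not true  = mk⇔ (λ ()) (λ ¬t → ¬t _)

∈-∖ : ∀ (F G : Family n) {ρ} → ρ ∈ᶠ F ∖ G ⇔ (ρ ∈ᶠ F × ¬ ρ ∈ᶠ G)
∈-∖ F G {ρ} = mk⇔
  (λ t → let f , g = to T-∧ t in f , to (T-not (G ρ)) g)
  (λ { (f , g) → from T-∧ (f , from (T-not (G ρ)) g) })

∈-∖｛｝ : ∀ (F : Family n) {σ ρ} → ρ ∈ᶠ F ∖ ｛ σ ｝ ⇔ (ρ ∈ᶠ F × ρ ≢ σ)
∈-∖｛｝ F {σ} {ρ} = mk⇔
  (λ t → let f , g = to (∈-∖ F ｛ σ ｝) t in f , g ∘ from (T-does (ρ ≟ˢ σ)))
  (λ { (f , g) → from (∈-∖ F ｛ σ ｝) (f , g ∘ to (T-does (ρ ≟ˢ σ))) })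

∈-｛｝∪｛｝ : ∀ (σ τ : Subset n) {ρ} → ρ ∈ᶠ ｛ σ ｝ ∪ᶠ ｛ τ ｝ ⇔ (ρ ≡ σ ⊎ ρ ≡ τ)
∈-｛｝∪｛｝ σ τ {ρ} = mk⇔
  ([ inj₁ ∘ to (T-does (ρ ≟ˢ σ)) , inj₂ ∘ to (T-does (ρ ≟ˢ τ)) ]′ ∘ to (T-∨ {｛ σ ｝ ρ}))
  (from (T-∨ {｛ σ ｝ ρ}) ∘ [ inj₁ ∘ from (T-does (ρ ≟ˢ σ)) , inj₂ ∘ from (T-does (ρ ≟ˢ τ)) ]′)

∈-allSubsets : (σ : Subset n) → σ ∈ˡ allSubsets n
∈-allSubsets Vec.[]              = here refl
∈-allSubsets (outside Vec.∷ σ) = ∈-++⁺ˡ (∈-map⁺ _ (∈-allSubsets σ))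
∈-allSubsets (inside  Vec.∷ σ) = ∈-++⁺ʳ (map (outside Vec.∷_) _) (∈-map⁺ _ (∈-allSubsets σ))

allSubsets-unique : ∀ n → Unique (allSubsets n)
allSubsets-unique zero    = All.[] ∷ []
allSubsets-unique (suc n) =
  ++⁺ (map⁺ Vec.∷-injectiveʳ (allSubsets-unique n)) (map⁺ Vec.∷-injectiveʳ (allSubsets-unique n)) disjoint
  where
  disjoint : ∀ {σ} → ¬ (σ ∈ˡ map (outside Vec.∷_) (allSubsets n) × σ ∈ˡ map (inside Vec.∷_) (allSubsets n))
  disjoint (σ∈out , σ∈in) with ∈-map⁻ _ σ∈out | ∈-map⁻ _ σ∈in
  ... | _ , _ , refl | _ , _ , ()

-- The recursion step common to both parts: f ν can be solved for in f(c) = 0,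
-- and P has the matching decomposition indexed by the members of c other than ν.
hasParity-recursion :
  ∀ (f : Subset n → Chain n) {c : Chain n} {κ ν} {P : List (Subset n) → Set}
    {Q : Subset n → List (Subset n) → Set} {g : List (Subset n) → List (Subset n)} →
  ν ∈ᶠ c → (f ⟦ c ⟧) κ ≡ false →
  (∀ {x y π} → Q x π → Q y π → x ≡ y) → (∀ {π π′} → g π ≡ g π′ → π ≡ π′) →
  (∀ ρ → ρ ∈ᶠ c ∖ ｛ ν ｝ → HasParity (Q ρ) (f ρ κ)) →
  (∀ π → (∃[ π′ ] (∃[ ρ ] ρ ∈ᶠ c ∖ ｛ ν ｝ × Q ρ π′) × π ≡ g π′) ⇔ P π) →
  HasParity P (f ν κ)
hasParity-recursion {n} f {c} {κ} {ν} {Q = Q} ν∈c f⟦c⟧≡0 Q-inj g-inj Q-par decomp =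
  subst (HasParity _) (sym fν≡)
    (hasParity-resp-⇔ decomp
      (hasParity-image g-inj
        (hasParity-resp-⇔
          (λ π → mk⇔ (λ { (ρ , _ , q) → ρ , q }) (λ { (ρ , q) → ρ , ∈-allSubsets ρ , q }))
          (hasParity-⨁ (c ∖ ｛ ν ｝) (λ ρ → f ρ κ) Q-inj Q-par (allSubsets-unique n)))))
  where
  at-ν : (c ∖ ｛ ν ｝) ν ∧ f ν κ ≡ false
  at-ν with ν ≟ˢ ν
  ... | yes _  = cong (_∧ f ν κ) (∧-zeroʳ (c ν))
  ... | no ν≢ν = contradiction refl ν≢ν

  off-ν : ∀ ρ → ρ ≢ ν → c ρ ∧ f ρ κ ≡ (c ∖ ｛ ν ｝) ρ ∧ f ρ κ
  off-ν ρ ρ≢ν with ρ ≟ˢ ν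
  ... | yes ρ≡ν = contradiction ρ≡ν ρ≢ν
  ... | no _    = cong (_∧ f ρ κ) (sym (∧-identityʳ (c ρ)))

  -- In characteristic 2, a vanishing sum of `f ν κ` and the remaining terms means that the two
  -- agree.
  fν≡ : f ν κ ≡ (f ⟦ c ∖ ｛ ν ｝ ⟧) κ
  fν≡ = xor≡false⇒≡ _ _
    (trans (cong (λ b → (b ∧ f ν κ) xor (f ⟦ c ∖ ｛ ν ｝ ⟧) κ) (sym (to T-≡ ν∈c)))
      (trans (sym (⨁-delete at-ν off-ν (allSubsets-unique n) (∈-allSubsets ν))) f⟦c⟧≡0))

-- Dimension and codimension one

∣p∪⁅x⁆∣≡1+∣p∣ : (p : Subset n) {x : Fin n} → x ∉ p → ∣ p ∪ ⁅ x ⁆ ∣ ≡ suc ∣ p ∣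
∣p∪⁅x⁆∣≡1+∣p∣ (inside  Vec.∷ p) {zero}  x∉p = contradiction Vec.here x∉p
∣p∪⁅x⁆∣≡1+∣p∣ (outside Vec.∷ p) {zero}  x∉p = cong (suc ∘ ∣_∣) (∪-identityʳ p)
∣p∪⁅x⁆∣≡1+∣p∣ (inside  Vec.∷ p) {suc x} x∉p = cong suc (∣p∪⁅x⁆∣≡1+∣p∣ p (x∉p ∘ Vec.there))
∣p∪⁅x⁆∣≡1+∣p∣ (outside Vec.∷ p) {suc x} x∉p = ∣p∪⁅x⁆∣≡1+∣p∣ p (x∉p ∘ Vec.there)

nonempty⇒∣p∣≢0 : (p : Subset n) → Nonempty p → ∣ p ∣ ≢ 0
nonempty⇒∣p∣≢0 (outside Vec.∷ p) (suc x , Vec.there x∈p) = nonempty⇒∣p∣≢0 p (x , x∈p)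

-- Non-emptiness rules out truncation: for empty `σ` and a one-element `τ`, `dim` would be 0 for
-- both.
dim-suc : ∀ (σ τ : Subset n) → Nonempty σ → ∣ τ ∣ ≡ suc ∣ σ ∣ → dim τ ≡ suc (dim σ)
dim-suc σ τ ne eq rewrite eq with ∣ σ ∣ | nonempty⇒∣p∣≢0 σ ne
... | zero  | ≢0 = contradiction refl ≢0
... | suc _ | _  = refl

-- The common form of `∂` and `δ`: `b` is membership in `K` of the face `σ` for `∂`, of the coface
-- `τ` for `δ`.
∧-codim-one : ∀ b (σ τ : Subset n) → T (b ∧ does (σ ⊆? τ) ∧ does (dim τ ≟ suc (dim σ))) ⇔
                                     (T b × σ ⊆ τ × dim τ ≡ suc (dim σ))
∧-codim-one b σ τ = mk⇔
  (map₂ (Product.map (to ⊆⇔) (to dim⇔) ∘ to T-∧) ∘ to T-∧)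
  (from T-∧ ∘ map₂ (from T-∧ ∘ Product.map (from ⊆⇔) (from dim⇔)))
  where
  ⊆⇔   = T-does (σ ⊆? τ)
  dim⇔ = T-does (dim τ ≟ suc (dim σ))

∈∂⇔ : ∀ (K : Complex n) {σ τ} → σ ∈ᶠ ∂ K τ ⇔ (σ ∈ᴷ K × σ ⊆ τ × dim τ ≡ suc (dim σ))
∈∂⇔ K {σ} {τ} = ∧-codim-one (simplices K σ) σ τ

∈δ⇔ : ∀ (K : Complex n) {σ τ} → τ ∈ᶠ δ K σ ⇔ (τ ∈ᴷ K × σ ⊆ τ × dim τ ≡ suc (dim σ))
∈δ⇔ K {σ} {τ} = ∧-codim-one (simplices K τ) σ τ

-- A vertex x of τ outside σ gives the simplex σ ∪ {x} ≠ σ, which is τ by freeness.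
freePair-dim : ∀ (K : Complex n) {σ τ} → IsFreePair K σ τ → dim τ ≡ suc (dim σ)
freePair-dim K {σ} {τ} (σ∈K , τ∈K , (σ⊆τ , x , x∈τ , x∉σ) , only) =
  dim-suc σ τ ne (trans (cong ∣_∣ (sym σ∪x≡τ)) (∣p∪⁅x⁆∣≡1+∣p∣ σ x∉σ))
  where
  ne = nonempty K σ σ∈K

  σ∪x⊆τ : σ ∪ ⁅ x ⁆ ⊆ τ
  σ∪x⊆τ y∈ with x∈p∪q⁻ σ ⁅ x ⁆ y∈
  ... | inj₁ y∈σ = σ⊆τ y∈σ
  ... | inj₂ y∈x = subst (_∈ τ) (sym (x∈⁅y⁆⇒x≡y x y∈x)) x∈τ

  x∈σ∪x : x ∈ σ ∪ ⁅ x ⁆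
  x∈σ∪x = q⊆p∪q σ ⁅ x ⁆ (x∈⁅x⁆ x)

  σ∪x≡τ : σ ∪ ⁅ x ⁆ ≡ τ
  σ∪x≡τ = only _ (closed K _ τ τ∈K σ∪x⊆τ (x , x∈σ∪x)) (p⊆p∪q ⁅ x ⁆)
                 (λ eq → x∉σ (subst (x ∈_) eq x∈σ∪x))

module _ {n : ℕ} {K : Complex n} (W : MorseSequence K) where
  open MorseSequence W

  private variable
    κ ν ρ σ σ′ τ τ′ : Subset n
    i j : Fin len
    p : ℕ

  -- The stages of the sequence

  New : Fin len → Subset n → Set
  New i ρ = ρ ∈ᴷ stage (suc i) × ¬ ρ ∈ᴷ stage (inject₁ i)

  Expansion : Fin len → Subset n → Subset n → Set
  Expansion i σ τ = IsExpansion (stage (inject₁ i)) (stage (suc i)) σ τ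

  Filling : Fin len → Subset n → Set
  Filling i ν = IsFilling (stage (inject₁ i)) (stage (suc i)) ν

  private
    stage-∖ : ∀ (G : Family n) → simplices (stage (inject₁ i)) ≗ simplices (stage (suc i)) ∖ G →
              ρ ∈ᴷ stage (inject₁ i) ⇔ (ρ ∈ᴷ stage (suc i) × ¬ ρ ∈ᶠ G)
    stage-∖ {i} G eq = mk⇔ (to ∖⇔ ∘ subst T (eq _)) (subst T (sym (eq _)) ∘ from ∖⇔)
      where ∖⇔ = ∈-∖ (simplices (stage (suc i))) G

  expansion-old : Expansion i σ τ →
                  ρ ∈ᴷ stage (inject₁ i) ⇔ (ρ ∈ᴷ stage (suc i) × ρ ≢ σ × ρ ≢ τ)
  expansion-old {σ = σ} {τ} (_ , eq) = mk⇔
    (λ ρ∈ → let ρ∈′ , ∉ = to ∖⇔ ρ∈ in ρ∈′ , ∉ ∘ from ∈⇔ ∘ inj₁ , ∉ ∘ from ∈⇔ ∘ inj₂)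
    (λ { (ρ∈ , ≢σ , ≢τ) → from ∖⇔ (ρ∈ , [ ≢σ , ≢τ ]′ ∘ to ∈⇔) })
    where
    ∖⇔ = stage-∖ (｛ σ ｝ ∪ᶠ ｛ τ ｝) eq
    ∈⇔ = ∈-｛｝∪｛｝ σ τ

  filling-old : Filling i ν → ρ ∈ᴷ stage (inject₁ i) ⇔ (ρ ∈ᴷ stage (suc i) × ρ ≢ ν)
  filling-old {ν = ν} {ρ} (_ , eq) = mk⇔
    (λ ρ∈ → let ρ∈′ , ∉ = to ∖⇔ ρ∈ in ρ∈′ , ∉ ∘ from (T-does (ρ ≟ˢ ν)))
    (λ { (ρ∈ , ≢ν) → from ∖⇔ (ρ∈ , ≢ν ∘ to (T-does (ρ ≟ˢ ν))) })
    where ∖⇔ = stage-∖ ｛ ν ｝ eq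

  expansion-new : Expansion i σ τ → New i ρ → ρ ≡ σ ⊎ ρ ≡ τ
  expansion-new {σ = σ} {τ} {ρ} e (ρ∈ , ρ∉) with ρ ≟ˢ σ | ρ ≟ˢ τ
  ... | yes ρ≡σ | _       = inj₁ ρ≡σ
  ... | no _    | yes ρ≡τ = inj₂ ρ≡τ
  ... | no ρ≢σ  | no ρ≢τ  = contradiction (from (expansion-old e) (ρ∈ , ρ≢σ , ρ≢τ)) ρ∉

  filling-new : Filling i ν → New i ρ → ρ ≡ ν
  filling-new {ν = ν} {ρ} f (ρ∈ , ρ∉) with ρ ≟ˢ ν
  ... | yes ρ≡ν = ρ≡ν
  ... | no ρ≢ν  = contradiction (from (filling-old f) (ρ∈ , ρ≢ν)) ρ∉

  new-lower : Expansion i σ τ → New i σ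
  new-lower e@((σ∈ , _) , _) = σ∈ , λ σ∈′ → proj₁ (proj₂ (to (expansion-old e) σ∈′)) refl

  new-upper : Expansion i σ τ → New i τ
  new-upper e@((_ , τ∈ , _) , _) = τ∈ , λ τ∈′ → proj₂ (proj₂ (to (expansion-old e) τ∈′)) refl

  new-critical : Filling i ν → New i ν
  new-critical f@((ν∈ , _) , _) = ν∈ , λ ν∈′ → proj₂ (to (filling-old f) ν∈′) refl

  stage-step : ∀ i → ρ ∈ᴷ stage (inject₁ i) → ρ ∈ᴷ stage (suc i)
  stage-step i ρ∈ with step i
  ... | inj₁ (_ , _ , e) = proj₁ (to (expansion-old e) ρ∈)
  ... | inj₂ (_ , f)     = proj₁ (to (filling-old f) ρ∈)

  stage-mono : ∀ {k l} → k Fin.≤ l → ρ ∈ᴷ stage k → ρ ∈ᴷ stage l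
  stage-mono {ρ} k≤l ρ∈ = <-weakInduction-startingFrom (λ l → ρ ∈ᴷ stage l) ρ∈ stage-step k≤l

  stage⇒K : ∀ {k} → ρ ∈ᴷ stage k → ρ ∈ᴷ K
  stage⇒K {ρ} {k} ρ∈ = subst T (end ρ) (stage-mono (Fin.≤fromℕ k) ρ∈)

  -- A simplex new at step `i` lies in `stage (suc i)`, hence in all later stages, so it cannot be
  -- absent just before a later step `j`.
  new-not-< : New i ρ → New j ρ → ¬ i Fin.< j
  new-not-< {j = j} (ρ∈ , _) (_ , ρ∉) i<j =
    ρ∉ (stage-mono (≤-trans i<j (≤-reflexive (sym (Fin.toℕ-inject₁ j)))) ρ∈)

  new-unique : New i ρ → New j ρ → i ≡ j
  new-unique {i} {j = j} newᵢ newⱼ with Fin.<-cmp i j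
  ... | tri< i<j _ _ = contradiction i<j (new-not-< newᵢ newⱼ)
  ... | tri≈ _ i≡j _ = i≡j
  ... | tri> _ _ j<i = contradiction j<i (new-not-< newⱼ newᵢ)

  -- Regular pairs and critical simplices

  pair-⊂ : IsRegularPair W σ τ → σ ⊂ τ
  pair-⊂ (_ , (_ , _ , σ⊂τ , _) , _) = σ⊂τ

  pair-dim : IsRegularPair W σ τ → dim τ ≡ suc (dim σ)
  pair-dim (i , free , _) = freePair-dim (stage (suc i)) free

  pair-lower∈K : IsRegularPair W σ τ → σ ∈ᴷ K
  pair-lower∈K (_ , e) = stage⇒K (proj₁ (new-lower e))

  pair-upper∈K : IsRegularPair W σ τ → τ ∈ᴷ K
  pair-upper∈K (_ , e) = stage⇒K (proj₁ (new-upper e))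

  -- `σ` is new at only one step, so both pairs come from one expansion, which adds nothing besides
  -- `σ` and `τ`; `τ′ = σ` would contradict strict inclusion.
  upper-unique : IsRegularPair W σ τ → IsRegularPair W σ τ′ → τ′ ≡ τ
  upper-unique (i , e) r′@(j , e′) with refl ← new-unique (new-lower e) (new-lower e′)
    with expansion-new e (new-upper e′)
  ... | inj₁ refl  = ⊥-elim (⊂-irref refl (pair-⊂ r′))
  ... | inj₂ τ′≡τ = τ′≡τ

  lower-unique : IsRegularPair W σ τ → IsRegularPair W σ′ τ → σ′ ≡ σ
  lower-unique (i , e) r′@(j , e′) with refl ← new-unique (new-upper e) (new-upper e′)
    with expansion-new e (new-lower e′)
  ... | inj₁ σ′≡σ = σ′≡σ
  ... | inj₂ refl  = ⊥-elim (⊂-irref refl (pair-⊂ r′))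

  -- A filling adds one simplex, so a pair sharing its step would have equal members.
  critical⇒¬lower : IsCritical W ν → ¬ IsLowerRegular W ν
  critical⇒¬lower (i , f) (_ , r@(j , e)) with refl ← new-unique (new-critical f) (new-lower e) =
    ⊂-irref (sym (filling-new f (new-upper e))) (pair-⊂ r)

  critical⇒¬upper : IsCritical W ν → ¬ IsUpperRegular W ν
  critical⇒¬upper (i , f) (_ , r@(j , e)) with refl ← new-unique (new-critical f) (new-upper e) =
    ⊂-irref (filling-new f (new-lower e)) (pair-⊂ r)

  -- Both pairs would belong to a single step, so the partner above `ν` would be `ν` itself or its
  -- partner below.
  lower⇒¬upper : IsLowerRegular W ν → ¬ IsUpperRegular W ν
  lower⇒¬upper (_ , r@(i , e)) (_ , r′@(j , e′)) with refl ← new-unique (new-lower e) (new-upper e′)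
    with expansion-new e′ (new-upper e)
  ... | inj₁ refl = ⊂-asymmetric (pair-⊂ r) (pair-⊂ r′)
  ... | inj₂ refl = ⊂-irref refl (pair-⊂ r)

  lower∈∂ : IsRegularPair W σ τ → σ ∈ᶠ ∂ K τ
  lower∈∂ r = from (∈∂⇔ K) (pair-lower∈K r , p⊂q⇒p⊆q (pair-⊂ r) , pair-dim r)

  upper∈δ : IsRegularPair W σ τ → τ ∈ᶠ δ K σ
  upper∈δ r = from (∈δ⇔ K) (pair-upper∈K r , p⊂q⇒p⊆q (pair-⊂ r) , pair-dim r)

  -- `stage (suc i)` contains `τ` and is closed under faces; only `σ` and `τ` are missing one stage
  -- earlier, and `σ′ = τ` fails by dimension.
  faces-earlier : Expansion i σ τ → σ′ ∈ᶠ ∂ K τ → σ′ ≢ σ → σ′ ∈ᴷ stage (inject₁ i)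
  faces-earlier {i} {σ′ = σ′} e σ′∈∂τ σ′≢σ with to (∈∂⇔ K) σ′∈∂τ
  ... | σ′∈K , σ′⊆τ , dim≡ = from (expansion-old e)
    ( closed (stage (suc i)) σ′ _ (proj₁ (new-upper e)) σ′⊆τ (nonempty K σ′ σ′∈K)
    , σ′≢σ , λ { refl → 1+n≢n (sym dim≡) })

  -- Freeness makes `τ` the only simplex of `stage (suc i)` properly containing `σ`.
  cofaces-later : Expansion i σ τ → τ′ ∈ᶠ δ K σ → τ′ ≢ τ → ¬ τ′ ∈ᴷ stage (suc i)
  cofaces-later ((_ , _ , _ , only) , _) τ′∈δσ τ′≢τ τ′∈ with to (∈δ⇔ K) τ′∈δσ
  ... | _ , σ⊆τ′ , dim≡ = τ′≢τ (only _ τ′∈ σ⊆τ′ (λ { refl → 1+n≢n (sym dim≡) }))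

  -- Gradient paths

  gradient-start : ∀ {π} → IsGradientPathᵖ W p ν κ π → ν ∈ K ⟨ p ⟩
  gradient-start (trivial ν∈)            = ν∈
  gradient-start (extend ν∈ _ _ _ _ _) = ν∈

  -- The start is the head of the list. This gives disjointness when paths are sorted by their
  -- second lower simplex.
  gradient-start-unique : ∀ {π} → IsGradientPath W ν κ π → IsGradientPath W ρ κ π → ν ≡ ρ
  gradient-start-unique (_ , trivial _)              (_ , trivial _)              = refl
  gradient-start-unique (_ , extend _ _ _ _ _ _) (_ , extend _ _ _ _ _ _) = refl

  gradient-nonlower : ν ∈ᴷ K → ¬ IsLowerRegular W ν →
                      ∀ π → (κ ≡ ν × π ≡ [ ν ]) ⇔ IsGradientPath W ν κ π
  gradient-nonlower ν∈K ¬lower π = mk⇔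
    (λ { (refl , refl) → _ , trivial (ν∈K , refl) })
    (λ { (_ , trivial _) → refl , refl
       ; (_ , extend _ _ r _ _ _) → contradiction (_ , r) ¬lower })

  -- A critical `κ` differs from `σ`, so no path is trivial, and `upper-unique` forces the second
  -- entry to be `τ`. What follows is a path from a face `ρ ≠ σ`.
  gradient-lower : IsCritical W κ → IsRegularPair W σ τ →
                   ∀ π → (∃[ π′ ] (∃[ ρ ] ρ ∈ᶠ ∂ K τ ∖ ｛ σ ｝ × IsGradientPath W ρ κ π′)
                                  × π ≡ σ ∷ τ ∷ π′)
                         ⇔ IsGradientPath W σ κ π
  gradient-lower {κ} {σ} {τ} crit r π = mk⇔ join split
    where
    join : _ → IsGradientPath W σ κ π
    join (_ , (_ , ρ∈ , _ , path) , refl) =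
      let ρ∈∂ , ρ≢σ = to (∈-∖｛｝ (∂ K τ)) ρ∈
          _ , _ , dimτ≡ = to (∈∂⇔ K) ρ∈∂
          dimρ≡p = proj₂ (gradient-start path)
      in _ , extend
               -- `σ` and `ρ` both have codimension one in `τ`, so `dim σ` equals `dim ρ`, the
               -- dimension of the remaining path.
               (pair-lower∈K r , trans (suc-injective (trans (sym (pair-dim r)) dimτ≡)) dimρ≡p)
               (pair-upper∈K r , trans dimτ≡ (cong suc dimρ≡p))
               r ρ∈∂ ρ≢σ path

    split : IsGradientPath W σ κ π → _
    split (_ , trivial _) = contradiction (_ , r) (critical⇒¬lower crit)
    split (p , extend _ _ r′ ρ∈∂ ρ≢σ path) with refl ← upper-unique r r′ =
      _ , (_ , from (∈-∖｛｝ (∂ K τ)) (ρ∈∂ , ρ≢σ) , p , path) , refl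

  -- Parity for the reference map

  module _ {⋏ : Subset n → Chain n} (ref : IsReferenceMap W ⋏) {κ : Subset n} (crit : IsCritical W κ) where
    open IsReferenceMap ref

    private
      -- The whole stage is covered, since faces of `τ` may have entered at any earlier step.
      P : Fin (suc len) → Set
      P k = ∀ ν → ν ∈ᴷ stage k → HasParity (IsGradientPath W ν κ) (⋏ ν κ)

      -- Shared by critical and upper regular `ν`: only a trivial path can reach `κ`, and it exists
      -- exactly when `κ = ν`.
      nonlower : ν ∈ᴷ K → ¬ IsLowerRegular W ν → ⋏ ν κ ≡ does (κ ≟ˢ ν) →
                 HasParity (IsGradientPath W ν κ) (⋏ ν κ)
      nonlower {ν} ν∈K ¬lower eq = subst (HasParity _) (sym eq)
        (hasParity-resp-⇔ (gradient-nonlower ν∈K ¬lower) (hasParity-singleton [ ν ] (κ ≟ˢ ν)))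

      P-step : ∀ i → P (inject₁ i) → P (suc i)
      P-step i rec ν ν∈ with step i
      P-step i rec ν ν∈ | inj₂ (ρ , f) with ν ≟ˢ ρ
      ... | no ν≢ρ   = rec ν (from (filling-old f) (ν∈ , ν≢ρ))
      ... | yes refl =
        nonlower (stage⇒K ν∈) (critical⇒¬lower (i , f)) (on-critical ν (i , f) κ)
      P-step i rec ν ν∈ | inj₁ (σ , τ , e) with ν ≟ˢ σ | ν ≟ˢ τ
      ... | no ν≢σ | no ν≢τ = rec ν (from (expansion-old e) (ν∈ , ν≢σ , ν≢τ))
      ... | yes refl | _ =
        hasParity-recursion ⋏ (lower∈∂ (i , e)) (on-∂-upper τ (σ , i , e) κ)
          gradient-start-unique (∷-injectiveʳ ∘ ∷-injectiveʳ)
          (λ ρ ρ∈ → let ρ∈∂ , ρ≢σ = to (∈-∖｛｝ (∂ K τ)) ρ∈ in rec ρ (faces-earlier e ρ∈∂ ρ≢σ))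
          (gradient-lower crit (i , e))
      -- `⋏ τ` is zero, and the critical `κ` cannot be the upper regular `τ`, so both sides of the
      -- equation are `false`.
      ... | no _ | yes refl = nonlower (stage⇒K ν∈) (λ lower → lower⇒¬upper lower upper)
        (trans (on-upper τ upper κ) (sym κ≢τ))
        where
        upper = σ , i , e
        κ≢τ : does (κ ≟ˢ τ) ≡ false
        κ≢τ with κ ≟ˢ τ
        ... | yes refl = contradiction upper (critical⇒¬upper crit)
        ... | no _     = refl

    reference-parity : ∀ ν → ν ∈ᴷ K → HasParity (IsGradientPath W ν κ) (⋏ ν κ)
    reference-parity ν ν∈K =
      <-weakInduction P (λ ν ν∈ → ⊥-elim (subst T (start ν) ν∈)) P-step
        (fromℕ len) ν (subst T (sym (end ν)) ν∈K)

  -- Cogradient paths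

  cogradient-end : ∀ {π} → IsCogradientPathᵖ W p κ ν π → ν ∈ K ⟨ p ⟩
  cogradient-end (trivial ν∈)               = ν∈
  cogradient-end (extend _ _ _ _ _ path) = cogradient-end path

  -- The end is the last entry of the list. Starts and dimensions may differ, because the tails in
  -- the recursion begin at simplices not yet known to be equal.
  cogradient-end-unique : ∀ {π q κ′} → IsCogradientPathᵖ W p κ ν π → IsCogradientPathᵖ W q κ′ ρ π → ν ≡ ρ
  cogradient-end-unique (trivial _)               (trivial _)                = refl
  cogradient-end-unique (extend _ _ _ _ _ path) (extend _ _ _ _ _ path′) =
    cogradient-end-unique path path′

  -- Paths are built from the front, whereas the recursion for `⋎` acts at the end; this and
  -- `cogradient-unsnoc` translate between the two.
  cogradient-snoc : ∀ {q π} → σ ∈ K ⟨ q ⟩ → ν ∈ K ⟨ suc q ⟩ → IsRegularPair W σ ν →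
                    ρ ∈ᶠ δ K σ → ν ≢ ρ → IsCogradientPathᵖ W (suc q) κ ρ π →
                    IsCogradientPathᵖ W (suc q) κ ν (π ++ σ ∷ ν ∷ [])
  cogradient-snoc σ∈ ν∈ r ρ∈δ ν≢ρ (trivial ρ∈) = extend ρ∈ σ∈ r ρ∈δ ν≢ρ (trivial ν∈)
  cogradient-snoc σ∈ ν∈ r ρ∈δ ν≢ρ (extend a b c d e path) =
    extend a b c d e (cogradient-snoc σ∈ ν∈ r ρ∈δ ν≢ρ path)

  cogradient-unsnoc : ∀ {π} → IsCogradientPathᵖ W p κ ν π →
    (κ ≡ ν × π ≡ [ ν ]) ⊎
    (∃[ σ ] ∃[ ρ ] ∃[ π′ ] IsRegularPair W σ ν × ρ ∈ᶠ δ K σ × ρ ≢ ν ×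
                           IsCogradientPathᵖ W p κ ρ π′ × π ≡ π′ ++ σ ∷ ν ∷ [])
  cogradient-unsnoc (trivial _) = inj₁ (refl , refl)
  cogradient-unsnoc (extend κ∈ σ∈ r κ∈δ τ′≢κ path) with cogradient-unsnoc path
  -- With a trivial tail the first step is also the last, and the penultimate simplex is the start
  -- `κ`.
  ... | inj₁ (refl , refl) =
    inj₂ (_ , _ , _ , r , κ∈δ , τ′≢κ ∘ sym , trivial κ∈ , refl)
  ... | inj₂ (_ , _ , _ , r′ , ρ∈δ , ρ≢ν , path′ , refl) =
    inj₂ (_ , _ , _ , r′ , ρ∈δ , ρ≢ν , extend κ∈ σ∈ r κ∈δ τ′≢κ path′ , refl)

  cogradient-nonupper : ν ∈ᴷ K → ¬ IsUpperRegular W ν →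
                        ∀ π → (κ ≡ ν × π ≡ [ ν ]) ⇔ IsCogradientPath W κ ν π
  cogradient-nonupper {ν} {κ} ν∈K ¬upper π = mk⇔ (λ { (refl , refl) → _ , trivial (ν∈K , refl) }) only-trivial
    where
    only-trivial : IsCogradientPath W κ ν π → κ ≡ ν × π ≡ [ ν ]
    only-trivial (_ , path) with cogradient-unsnoc path
    ... | inj₁ eqs             = eqs
    ... | inj₂ (_ , _ , _ , r , _) = contradiction (_ , r) ¬upper

  -- A critical `κ` is not `τ`, so each path has a last step, and `lower-unique` forces its lower
  -- simplex to be `σ`.
  cogradient-upper : IsCritical W κ → IsRegularPair W σ τ →
                     ∀ π → (∃[ π′ ] (∃[ ρ ] ρ ∈ᶠ δ K σ ∖ ｛ τ ｝ × IsCogradientPath W κ ρ π′)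
                                    × π ≡ π′ ++ σ ∷ τ ∷ [])
                           ⇔ IsCogradientPath W κ τ π
  cogradient-upper {κ} {σ} {τ} crit r π = mk⇔ join split
    where
    join : _ → IsCogradientPath W κ τ π
    join (_ , (_ , ρ∈ , _ , path) , refl)
      with ρ∈δ , ρ≢τ ← to (∈-∖｛｝ (δ K σ)) ρ∈
      with _ , _ , dimρ≡ ← to (∈δ⇔ K {σ}) ρ∈δ
      -- The path to `ρ` has dimension `dim ρ = suc (dim σ)`; matching on this gives the successor
      -- index that `cogradient-snoc` requires.
      with refl ← trans (sym (proj₂ (cogradient-end path))) dimρ≡ =
      _ , cogradient-snoc (pair-lower∈K r , refl) (pair-upper∈K r , pair-dim r) r ρ∈δ (ρ≢τ ∘ sym) path

    split : IsCogradientPath W κ τ π → _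
    split (p , path) with cogradient-unsnoc path
    ... | inj₁ (refl , _) = contradiction (_ , r) (critical⇒¬upper crit)
    ... | inj₂ (_ , _ , _ , r′ , ρ∈δ , ρ≢τ , path′ , refl) with refl ← lower-unique r r′ =
      _ , (_ , from (∈-∖｛｝ (δ K σ)) (ρ∈δ , ρ≢τ) , p , path′) , refl

  -- Parity for the coreference map

  module _ {⋎ : Subset n → Chain n} (coref : IsCoreferenceMap W ⋎) {κ : Subset n} (crit : IsCritical W κ) where
    open IsCoreferenceMap coref

    private
      -- Cofaces enter later, so the predicate concerns simplices outside a stage and grows stronger
      -- as `k` decreases.
      P : Fin (suc len) → Set
      P k = ∀ ν → ν ∈ᴷ K → ¬ ν ∈ᴷ stage k → HasParity (IsCogradientPath W κ ν) (⋎ ν κ)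

      nonupper : ν ∈ᴷ K → ¬ IsUpperRegular W ν → ⋎ ν κ ≡ does (κ ≟ˢ ν) →
                 HasParity (IsCogradientPath W κ ν) (⋎ ν κ)
      nonupper {ν} ν∈K ¬upper eq = subst (HasParity _) (sym eq)
        (hasParity-resp-⇔ (cogradient-nonupper ν∈K ¬upper) (hasParity-singleton [ ν ] (κ ≟ˢ ν)))

      P-step : ∀ i → P (suc i) → P (inject₁ i)
      P-step i rec ν ν∈K ν∉ with step i
      P-step i rec ν ν∈K ν∉ | inj₂ (ρ , f) with ν ≟ˢ ρ
      ... | no ν≢ρ   = rec ν ν∈K (λ ν∈ → ν∉ (from (filling-old f) (ν∈ , ν≢ρ)))
      ... | yes refl = nonupper ν∈K (critical⇒¬upper (i , f)) (on-critical ν (i , f) κ)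
      P-step i rec ν ν∈K ν∉ | inj₁ (σ , τ , e) with ν ≟ˢ σ | ν ≟ˢ τ
      ... | no ν≢σ | no ν≢τ = rec ν ν∈K (λ ν∈ → ν∉ (from (expansion-old e) (ν∈ , ν≢σ , ν≢τ)))
      ... | no _ | yes refl =
        hasParity-recursion ⋎ (upper∈δ (i , e)) (on-δ-lower σ (τ , i , e) κ)
          (λ { (_ , path) (_ , path′) → cogradient-end-unique path path′ })
          (++-cancelʳ _ _ _)
          (λ ρ ρ∈ → let ρ∈δ , ρ≢τ = to (∈-∖｛｝ (δ K σ)) ρ∈ in
                    rec ρ (proj₁ (to (∈δ⇔ K {σ}) ρ∈δ)) (cofaces-later e ρ∈δ ρ≢τ))
          (cogradient-upper crit (i , e))
      ... | yes refl | _ = nonupper ν∈K (lower⇒¬upper lower)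
        (trans (on-lower σ lower κ) (sym κ≢σ))
        where
        lower = τ , i , e
        κ≢σ : does (κ ≟ˢ σ) ≡ false
        κ≢σ with κ ≟ˢ σ
        ... | yes refl = contradiction lower (critical⇒¬lower crit)
        ... | no _     = refl

    coreference-parity : ∀ ν → ν ∈ᴷ K → HasParity (IsCogradientPath W κ ν) (⋎ ν κ)
    coreference-parity ν ν∈K =
      -- The descent starts at the last stage, outside which `K` has no simplex, and ends at the
      -- empty stage, outside which all lie.
      >-weakInduction P (λ ν ν∈K ν∉ → contradiction (subst T (sym (end ν)) ν∈K) ν∉) P-step
        zero ν ν∈K (λ ν∈ → subst T (start ν) ν∈)

theorem2 : ∀ {n : ℕ} (K : Complex n) (W : MorseSequence K)
    (⋏ ⋎ : Subset n → Chain n) → IsReferenceMap W ⋏ → IsCoreferenceMap W ⋎ →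
    ∀ (κ ν : Subset n) → IsCritical W κ → ν ∈ᴷ K →
    (∃[ m ] HasCardinality (IsGradientPath W ν κ) m × (κ ∈ᶠ ⋏ ν ⇔ Odd m))
    × (∃[ m ] HasCardinality (IsCogradientPath W κ ν) m × (κ ∈ᶠ ⋎ ν ⇔ Odd m))
theorem2 K W ⋏ ⋎ ref coref κ ν crit ν∈K =
  hasParity⇒odd (reference-parity W ref crit ν ν∈K) ,
  hasParity⇒odd (coreference-parity W coref crit ν ν∈K)
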